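{- Let $d\ge 2$, let $\vec a=(a_1,\ldots,a_d)$ be a vector of relatively prime positive integers, and let $t\in\mathbb{Z}^d$ be such that $\mathcal{F}_{\vec a}(t)=1$. Then the translate by $t$ of the Christoffel graph $\mathcal{H}_{\vec a}$ is equal to its flip: $\mathcal{H}_{\vec a}+t=\mathrm{flip}(\mathcal{H}_{\vec a})$.
   Context: $e_1,\ldots,e_d$ is the standard basis of $\mathbb{Z}^d$ and $\mathbb{E}_d=\{(u,u+e_i): u\in\mathbb{Z}^d,\ 1\le i\le d\}$. "Relatively prime" means $\gcd(a_1,\ldots,a_d)=1$. Put $s=\sum_i a_i$ and let $\mathcal{F}_{\vec a}:\mathbb{Z}^d\to\mathbb{Z}/s\mathbb{Z}$, $(x_1,\ldots,x_d)\mapsto\sum_i a_ix_i\bmod s$, where $\mathbb{Z}/s\mathbb{Z}$ is identified with $\{0,1,\ldots,s-1\}$ with its usual total order. The Christoffel graph of normal vector $\vec a$ is $\mathcal{H}_{\vec a}=\{(u,u+e_i)\in\mathbb{E}_d:\mathcal{F}_{\vec a}(u)<\mathcal{F}_{\vec a}(u+e_i)\}$. The set of edges incident to zero is $\mathcal{Q}=\{(u,v)\in\mathbb{E}_d:\mathcal{F}_{\vec a}(u)=0\text{ or }\mathcal{F}_{\vec a}(v)=0\}$. For $X\subseteq\mathbb{E}_d$: $\mathrm{flip}(X)=(X\setminus\mathcal{Q})\cup(\mathcal{Q}\setminus X)$ and $X+t=\{(u+t,v+t)\mid(u,v)\in X\}$. -}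

module Defs where

open import Data.Fin.Base using (Fin)
open import Data.Integer.Base as ℤ using (ℤ; +_; 0ℤ; 1ℤ; _%ℕ_)
open import Data.Nat.Base as ℕ using (ℕ; NonZero; _≤_; _<_; s≤s)
open import Data.Nat.GCD using (gcd)
import Data.Nat.Properties as ℕ
open import Data.Product.Base using (_×_; _,_; ∃-syntax)
open import Data.Sum.Base using (_⊎_)
open import Data.Vec.Base as Vec using (Vec; _∷_; sum; zipWith; foldr′; replicate; _[_]≔_)
open import Data.Vec.Relation.Unary.All using (All; _∷_)
open import Level using (0ℓ)
open import Relation.Binary.PropositionalEquality.Core using (_≡_)
open import Relation.Unary using (Pred; _∈_; _∪_; _∖_)

ℤ^_ : ℕ → Set
ℤ^ d = Vec ℤ d

infixl 6 _⊕_

_⊕_ : ∀ {d} → ℤ^ d → ℤ^ d → ℤ^ d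
_⊕_ = zipWith ℤ._+_

e : ∀ {d} → Fin d → ℤ^ d
e {d} i = replicate d 0ℤ [ i ]≔ 1ℤ

EdgeSet : ℕ → Set₁
EdgeSet d = Pred (ℤ^ d × ℤ^ d) 0ℓ

𝔼 : ∀ {d} → EdgeSet d
𝔼 (u , v) = ∃[ i ] v ≡ u ⊕ e i

infixl 6 _+ₜ_

_+ₜ_ : ∀ {d} → EdgeSet d → ℤ^ d → EdgeSet d
(X +ₜ t) f = ∃[ u ] ∃[ v ] (u , v) ∈ X × f ≡ (u ⊕ t , v ⊕ t)

Positive : ∀ {d} → Vec ℕ d → Set
Positive a = All (0 <_) a

RelativelyPrime : ∀ {d} → Vec ℕ d → Set
RelativelyPrime a = foldr′ gcd 0 a ≡ 1

sum-nonZero : ∀ {d} {a : Vec ℕ d} → 2 ≤ d → Positive a → NonZero (sum a)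
sum-nonZero {a = x ∷ xs} (s≤s _) (0<x ∷ _) =
  ℕ.>-nonZero (ℕ.≤-trans 0<x (ℕ.m≤m+n x (sum xs)))

module Christoffel {d : ℕ} (a : Vec ℕ d) .{{_ : NonZero (sum a)}} where

  -- Residues modulo s = sum a are represented by their canonical
  -- representatives 0, …, s - 1; _%ℕ_ is the Euclidean remainder, so
  -- this also holds for negative arguments.
  𝓕 : ℤ^ d → ℕ
  𝓕 x = foldr′ ℤ._+_ 0ℤ (zipWith (λ aᵢ xᵢ → + aᵢ ℤ.* xᵢ) a x) %ℕ sum a

  𝓗 : EdgeSet d
  𝓗 (u , v) = (u , v) ∈ 𝔼 × 𝓕 u < 𝓕 v

  𝓠 : EdgeSet d
  𝓠 (u , v) = (u , v) ∈ 𝔼 × (𝓕 u ≡ 0 ⊎ 𝓕 v ≡ 0)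

  flip : EdgeSet d → EdgeSet d
  flip X = (X ∖ 𝓠) ∪ (𝓠 ∖ X)

{-# OPTIONS --safe #-}

-- Write r, r′ for the residues of the endpoints of an edge. An edge whose
-- residues are r < r′ is translated to one whose residues are r + 1 and r′ + 1
-- modulo s; the order is preserved unless r′ = s - 1, in which case the new
-- edge is incident to zero and decreasing. Since 0 < aᵢ < s, the endpoints of
-- an edge never have equal residues, so this can be reversed.

module Submission where

open import Defs
open import Data.Fin.Base using (Fin; zero; suc)
open import Data.Integer.Base as ℤ using (ℤ; +_; 0ℤ; 1ℤ; _%ℕ_; _/ℕ_; ∣_∣)
import Data.Integer.DivMod as ℤ
import Data.Integer.Properties as ℤ
open import Data.Integer.Tactic.RingSolver using (solve-∀)
open import Data.Nat.Base using (ℕ; suc; NonZero; _⊔_; _≤_; _<_; s≤s; s<s; s<s⁻¹; z<s)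
open import Data.Nat.Divisibility using (_∣_; divides; n∣m⇒m%n≡0)
open import Data.Nat.DivMod using (m<n⇒m%n≡m)
import Data.Nat.Properties as ℕ
open import Data.Product.Base using (_×_; _,_)
open import Data.Sum.Base using (_⊎_; inj₁; inj₂)
open import Data.Vec.Base using (Vec; []; _∷_; lookup; sum; zipWith; foldr′; replicate; map)
open import Data.Vec.Properties
  using (zipWith-assoc; zipWith-comm; zipWith-identityʳ; zipWith-inverseˡ)
open import Data.Vec.Relation.Unary.All using (_∷_)
open import Data.Vec.Relation.Unary.All.Properties using (lookup⁺)
open import Relation.Binary.PropositionalEquality
  using (_≡_; _≢_; refl; sym; trans; cong; cong₂; subst; module ≡-Reasoning)
open import Relation.Nullary.Negation using (¬_; contradiction)
open import Relation.Unary using (_≐_; _∈_)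

∣∧<⇒≡0 : ∀ {m n} .{{_ : NonZero n}} → n ∣ m → m < n → m ≡ 0
∣∧<⇒≡0 {m} {n} n∣m m<n = trans (sym (m<n⇒m%n≡m m<n)) (n∣m⇒m%n≡0 m n n∣m)

-- The difference of `m` and `n` is a multiple of `s`, and its absolute value is at most the larger
-- of the two, hence below `s`; so it vanishes. The quotients are arbitrary, so a representation
-- need not come from `_/ℕ_`.
remainder-unique : ∀ {m n s} .{{_ : NonZero s}} (j k : ℤ) → m < s → n < s →
  + m ℤ.+ j ℤ.* + s ≡ + n ℤ.+ k ℤ.* + s → m ≡ n
remainder-unique {m} {n} {s} j k m<s n<s eq =
  ℤ.+-injective (ℤ.i-j≡0⇒i≡j (+ m) (+ n) (ℤ.∣i∣≡0⇒i≡0 (∣∧<⇒≡0 s∣m-n m-n<s)))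
  where
  rearrange : ∀ x y j k s → x ℤ.- y ≡ (x ℤ.+ j ℤ.* s) ℤ.- (y ℤ.+ k ℤ.* s) ℤ.+ (k ℤ.- j) ℤ.* s
  rearrange = solve-∀

  m-n≡[k-j]*s : + m ℤ.- + n ≡ (k ℤ.- j) ℤ.* + s
  m-n≡[k-j]*s = begin
    + m ℤ.- + n
      ≡⟨ rearrange (+ m) (+ n) j k (+ s) ⟩
    (+ m ℤ.+ j ℤ.* + s) ℤ.- (+ n ℤ.+ k ℤ.* + s) ℤ.+ (k ℤ.- j) ℤ.* + s
      ≡⟨ cong (ℤ._+ (k ℤ.- j) ℤ.* + s) (ℤ.i≡j⇒i-j≡0 eq) ⟩
    0ℤ ℤ.+ (k ℤ.- j) ℤ.* + s
      ≡⟨ ℤ.+-identityˡ _ ⟩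
    (k ℤ.- j) ℤ.* + s
      ∎
    where open ≡-Reasoning

  s∣m-n : s ∣ ∣ + m ℤ.- + n ∣
  s∣m-n = divides ∣ k ℤ.- j ∣ (trans (cong ∣_∣ m-n≡[k-j]*s) (ℤ.abs-* (k ℤ.- j) (+ s)))

  m-n<s : ∣ + m ℤ.- + n ∣ < s
  m-n<s = ℕ.≤-<-trans
    (subst (λ i → ∣ i ∣ ≤ m ⊔ n) (sym (ℤ.m-n≡m⊖n m n)) (ℤ.∣m⊝n∣≤m⊔n m n))
    (ℕ.⊔-pres-<m m<s n<s)

%ℕ-unique : ∀ {i r s} .{{_ : NonZero s}} (k : ℤ) → r < s → i ≡ + r ℤ.+ k ℤ.* + s → i %ℕ s ≡ r
%ℕ-unique {i} {r} {s} k r<s eq = remainder-unique (i /ℕ s) k (ℤ.n%ℕd<d i s) r<s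
  (trans (sym (ℤ.a≡a%ℕn+[a/ℕn]*n i s)) eq)

-- For `m < s` this is congruence of `n` to `m + 1` modulo `s`, split by whether the successor wraps
-- around. Matching on it turns `n` into a literal successor or zero, so order comparisons reduce.
SucMod : ℕ → ℕ → ℕ → Set
SucMod s m n = (suc m < s × n ≡ suc m) ⊎ (suc m ≡ s × n ≡ 0)

%ℕ-suc : ∀ s .{{_ : NonZero s}} (i j : ℤ) → j %ℕ s ≡ 1 → SucMod s (i %ℕ s) ((i ℤ.+ j) %ℕ s)
%ℕ-suc s i j j%s≡1 = go (ℕ.m≤n⇒m<n∨m≡n (ℤ.n%ℕd<d i s))
  where
  open ≡-Reasoning
  r = i %ℕ s

  interchange : ∀ r q q′ s →
    (r ℤ.+ q ℤ.* s) ℤ.+ (1ℤ ℤ.+ q′ ℤ.* s) ≡ (1ℤ ℤ.+ r) ℤ.+ (q ℤ.+ q′) ℤ.* s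
  interchange = solve-∀

  carry : ∀ q s → s ℤ.+ q ℤ.* s ≡ 0ℤ ℤ.+ (1ℤ ℤ.+ q) ℤ.* s
  carry = solve-∀

  q = i /ℕ s ℤ.+ j /ℕ s

  i+j : i ℤ.+ j ≡ + suc r ℤ.+ q ℤ.* + s
  i+j = begin
    i ℤ.+ j
      ≡⟨ cong₂ ℤ._+_ (ℤ.a≡a%ℕn+[a/ℕn]*n i s)
           (trans (ℤ.a≡a%ℕn+[a/ℕn]*n j s) (cong (λ k → + k ℤ.+ j /ℕ s ℤ.* + s) j%s≡1)) ⟩
    (+ r ℤ.+ i /ℕ s ℤ.* + s) ℤ.+ (1ℤ ℤ.+ j /ℕ s ℤ.* + s)
      ≡⟨ interchange (+ r) (i /ℕ s) (j /ℕ s) (+ s) ⟩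
    + suc r ℤ.+ q ℤ.* + s
      ∎

  go : suc r < s ⊎ suc r ≡ s → SucMod s r ((i ℤ.+ j) %ℕ s)
  go (inj₁ 1+r<s) = inj₁ (1+r<s , %ℕ-unique q 1+r<s i+j)
  -- On wrapping, the full `s` is carried into the quotient, which therefore grows by one.
  go (inj₂ 1+r≡s) = inj₂ (1+r≡s , %ℕ-unique (1ℤ ℤ.+ q) (subst (0 <_) 1+r≡s z<s) (begin
    i ℤ.+ j                       ≡⟨ i+j ⟩
    + suc r ℤ.+ q ℤ.* + s         ≡⟨ cong (λ k → + k ℤ.+ q ℤ.* + s) 1+r≡s ⟩
    + s ℤ.+ q ℤ.* + s             ≡⟨ carry q (+ s) ⟩
    0ℤ ℤ.+ (1ℤ ℤ.+ q) ℤ.* + s     ∎))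

-- With equal remainders, subtraction would leave `m` as a multiple of `s`; comparing it with
-- remainder `0` forces `m ≡ 0`.
%ℕ-+-≢ : ∀ s .{{_ : NonZero s}} (i : ℤ) {m} → 0 < m → m < s → i %ℕ s ≢ (i ℤ.+ + m) %ℕ s
%ℕ-+-≢ s i {m} 0<m m<s eq = ℕ.<⇒≢ 0<m (sym (remainder-unique 0ℤ (q′ ℤ.- q) m<s (ℕ.<-trans 0<m m<s) (begin
  + m ℤ.+ 0ℤ                                          ≡⟨ ℤ.+-identityʳ (+ m) ⟩
  + m                                                 ≡⟨ difference i (+ m) ⟩
  (i ℤ.+ + m) ℤ.- i
    ≡⟨ cong₂ ℤ._-_ (trans (ℤ.a≡a%ℕn+[a/ℕn]*n (i ℤ.+ + m) s) (cong (λ r → + r ℤ.+ q′ ℤ.* + s) (sym eq)))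
         (ℤ.a≡a%ℕn+[a/ℕn]*n i s) ⟩
  (+ r ℤ.+ q′ ℤ.* + s) ℤ.- (+ r ℤ.+ q ℤ.* + s)        ≡⟨ cancel (+ r) q q′ (+ s) ⟩
  0ℤ ℤ.+ (q′ ℤ.- q) ℤ.* + s                           ∎)))
  where
  open ≡-Reasoning
  r = i %ℕ s
  q = i /ℕ s
  q′ = (i ℤ.+ + m) /ℕ s

  difference : ∀ i m → m ≡ (i ℤ.+ m) ℤ.- i
  difference = solve-∀

  cancel : ∀ r q q′ s → (r ℤ.+ q′ ℤ.* s) ℤ.- (r ℤ.+ q ℤ.* s) ≡ 0ℤ ℤ.+ (q′ ℤ.- q) ℤ.* s
  cancel = solve-∀

-- Membership of an edge in `flip 𝓗`, in terms of the residues of its endpoints: in `𝓗` but not in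
-- `𝓠`, or in `𝓠` but not in `𝓗`.
FlippedOrder : ℕ → ℕ → Set
FlippedOrder n n′ = (n < n′ × ¬ (n ≡ 0 ⊎ n′ ≡ 0)) ⊎ ((n ≡ 0 ⊎ n′ ≡ 0) × ¬ n < n′)

<⇒FlippedOrder : ∀ {s m n m′ n′} → SucMod s m n → SucMod s m′ n′ → m < m′ → FlippedOrder n n′
<⇒FlippedOrder (inj₁ (_ , refl)) (inj₁ (_ , refl)) m<m′ =
  inj₁ (s<s m<m′ , λ { (inj₁ ()) ; (inj₂ ()) })
<⇒FlippedOrder _ (inj₂ (_ , refl)) _ = inj₂ (inj₂ refl , λ ())
-- If only the smaller residue wrapped, it would be `s - 1`, leaving no room for `m′` between it and
-- `s`.
<⇒FlippedOrder (inj₂ (refl , _)) (inj₁ (1+m′<s , _)) m<m′ =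
  contradiction (ℕ.<-trans m<m′ (s<s⁻¹ 1+m′<s)) (ℕ.<-irrefl refl)

-- The hypothesis `m ≢ m′` excludes the case where both residues wrap: there `n` and `n′` are both
-- zero, which satisfies `FlippedOrder`, although `m` and `m′` both equal `s - 1`.
FlippedOrder⇒< : ∀ {s m n m′ n′} → SucMod s m n → SucMod s m′ n′ → m ≢ m′ →
                 FlippedOrder n n′ → m < m′
FlippedOrder⇒< (inj₁ (_ , refl)) (inj₁ (_ , refl)) _ (inj₁ (n<n′ , _)) = s<s⁻¹ n<n′
FlippedOrder⇒< (inj₁ (_ , refl)) (inj₁ (_ , refl)) _ (inj₂ (inj₁ () , _))
FlippedOrder⇒< (inj₁ (_ , refl)) (inj₁ (_ , refl)) _ (inj₂ (inj₂ () , _))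
FlippedOrder⇒< (inj₁ (1+m<s , _)) (inj₂ (refl , _)) _ _ = s<s⁻¹ 1+m<s
FlippedOrder⇒< (inj₂ (_ , refl)) _ _ (inj₁ (_ , n,n′≢0)) = contradiction (inj₁ refl) n,n′≢0
FlippedOrder⇒< (inj₂ (_ , refl)) (inj₁ (_ , refl)) _ (inj₂ (_ , n≮n′)) = contradiction z<s n≮n′
FlippedOrder⇒< (inj₂ (refl , _)) (inj₂ (refl , _)) m≢m′ _ = contradiction refl m≢m′

⊕-assoc : ∀ {d} (x y z : ℤ^ d) → (x ⊕ y) ⊕ z ≡ x ⊕ (y ⊕ z)
⊕-assoc = zipWith-assoc ℤ.+-assoc

⊕-comm : ∀ {d} (x y : ℤ^ d) → x ⊕ y ≡ y ⊕ x
⊕-comm = zipWith-comm ℤ.+-comm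

⊕-swapʳ : ∀ {d} (x y z : ℤ^ d) → (x ⊕ y) ⊕ z ≡ (x ⊕ z) ⊕ y
⊕-swapʳ x y z = trans (⊕-assoc x y z) (trans (cong (x ⊕_) (⊕-comm y z)) (sym (⊕-assoc x z y)))

⊕-neg-cancel : ∀ {d} (x t : ℤ^ d) → (x ⊕ map ℤ.-_ t) ⊕ t ≡ x
⊕-neg-cancel x t = trans (⊕-assoc x _ t)
  (trans (cong (x ⊕_) (zipWith-inverseˡ ℤ.+-inverseˡ t)) (zipWith-identityʳ ℤ.+-identityʳ x))

-- `𝓕 x` unfolds to `dot a x %ℕ sum a`; linearity is proved here, before reduction modulo `sum a`.
dot : ∀ {d} → Vec ℕ d → ℤ^ d → ℤ
dot a x = foldr′ ℤ._+_ 0ℤ (zipWith (λ aᵢ xᵢ → + aᵢ ℤ.* xᵢ) a x)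

dot-⊕ : ∀ {d} (a : Vec ℕ d) (x y : ℤ^ d) → dot a (x ⊕ y) ≡ dot a x ℤ.+ dot a y
dot-⊕ []       []       []       = refl
dot-⊕ (a ∷ as) (x ∷ xs) (y ∷ ys) = trans
  (cong (λ i → + a ℤ.* (x ℤ.+ y) ℤ.+ i) (dot-⊕ as xs ys))
  (distrib (+ a) x y (dot as xs) (dot as ys))
  where
  distrib : ∀ a x y m n →
    a ℤ.* (x ℤ.+ y) ℤ.+ (m ℤ.+ n) ≡ (a ℤ.* x ℤ.+ m) ℤ.+ (a ℤ.* y ℤ.+ n)
  distrib = solve-∀

dot-0 : ∀ {d} (a : Vec ℕ d) → dot a (replicate d 0ℤ) ≡ 0ℤ
dot-0 []       = refl
dot-0 (a ∷ as) = cong₂ ℤ._+_ (ℤ.*-zeroʳ (+ a)) (dot-0 as)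

dot-e : ∀ {d} (a : Vec ℕ d) (i : Fin d) → dot a (e i) ≡ + lookup a i
dot-e (a ∷ as) zero    = trans (cong₂ ℤ._+_ (ℤ.*-identityʳ (+ a)) (dot-0 as)) (ℤ.+-identityʳ (+ a))
dot-e (a ∷ as) (suc i) = trans (cong₂ ℤ._+_ (ℤ.*-zeroʳ (+ a)) (dot-e as i)) (ℤ.+-identityˡ _)

lookup≤sum : ∀ {d} (a : Vec ℕ d) (i : Fin d) → lookup a i ≤ sum a
lookup≤sum (a ∷ as) zero    = ℕ.m≤m+n a (sum as)
lookup≤sum (a ∷ as) (suc i) = ℕ.≤-trans (lookup≤sum as i) (ℕ.m≤n+m (sum as) a)

-- Since `2 ≤ d`, some other positive entry contributes to the sum: the second one for index `zero`,
-- the head for any later index.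
lookup<sum : ∀ {d} {a : Vec ℕ d} → 2 ≤ d → Positive a → (i : Fin d) → lookup a i < sum a
lookup<sum {a = a ∷ b ∷ as} (s≤s (s≤s _)) (_ ∷ 0<b ∷ _) zero =
  ℕ.m<m+n a (ℕ.≤-trans 0<b (ℕ.m≤m+n b (sum as)))
lookup<sum {a = a ∷ as@(_ ∷ _)} (s≤s (s≤s _)) (0<a ∷ _) (suc i) =
  ℕ.+-mono-≤ 0<a (lookup≤sum as i)

module _ {d : ℕ} (a : Vec ℕ d) .{{_ : NonZero (sum a)}} where

  open Christoffel a

  𝓕-translate : ∀ {t} → 𝓕 t ≡ 1 → ∀ x → SucMod (sum a) (𝓕 x) (𝓕 (x ⊕ t))
  𝓕-translate {t} 𝓕t≡1 x =
    subst (λ i → SucMod (sum a) (𝓕 x) (i %ℕ sum a)) (sym (dot-⊕ a x t))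
      (%ℕ-suc (sum a) (dot a x) (dot a t) 𝓕t≡1)

  -- A step along `e i` adds the `i`-th entry of `a` to `dot a x`, and that entry lies strictly
  -- between `0` and `sum a`.
  𝓕-edge-≢ : 2 ≤ d → Positive a → ∀ x i → 𝓕 x ≢ 𝓕 (x ⊕ e i)
  𝓕-edge-≢ d≥2 pos x i =
    subst (λ j → 𝓕 x ≢ j %ℕ sum a)
      (sym (trans (dot-⊕ a x (e i)) (cong (λ j → dot a x ℤ.+ j) (dot-e a i))))
      (%ℕ-+-≢ (sum a) (dot a x) (lookup⁺ pos i) (lookup<sum d≥2 pos i))

  flip-𝓗⁺ : ∀ {u v} → (u , v) ∈ 𝔼 → FlippedOrder (𝓕 u) (𝓕 v) → (u , v) ∈ flip 𝓗
  flip-𝓗⁺ uv∈𝔼 (inj₁ (lt , ≢0)) = inj₁ ((uv∈𝔼 , lt) , λ (_ , ≡0) → ≢0 ≡0)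
  flip-𝓗⁺ uv∈𝔼 (inj₂ (≡0 , ≮)) = inj₂ ((uv∈𝔼 , ≡0) , λ (_ , lt) → ≮ lt)

  flip-𝓗⁻ : ∀ {u v} → (u , v) ∈ flip 𝓗 → (u , v) ∈ 𝔼 × FlippedOrder (𝓕 u) (𝓕 v)
  flip-𝓗⁻ (inj₁ ((uv∈𝔼 , lt) , ∉𝓠)) = uv∈𝔼 , inj₁ (lt , λ ≡0 → ∉𝓠 (uv∈𝔼 , ≡0))
  flip-𝓗⁻ (inj₂ ((uv∈𝔼 , ≡0) , ∉𝓗)) = uv∈𝔼 , inj₂ (≡0 , λ lt → ∉𝓗 (uv∈𝔼 , lt))

  𝓗-translate : 2 ≤ d → Positive a → ∀ t → 𝓕 t ≡ 1 → 𝓗 +ₜ t ≐ flip 𝓗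
  𝓗-translate d≥2 pos t 𝓕t≡1 = to , from
    where
    step = 𝓕-translate {t} 𝓕t≡1

    to : ∀ {f} → f ∈ 𝓗 +ₜ t → f ∈ flip 𝓗
    -- The translated pair is still an edge in direction `i`, because `e i` and `t` can be added in
    -- either order.
    to (u , v , ((i , refl) , lt) , refl) =
      flip-𝓗⁺ (i , ⊕-swapʳ u (e i) t) (<⇒FlippedOrder (step u) (step v) lt)

    from : ∀ {f} → f ∈ flip 𝓗 → f ∈ 𝓗 +ₜ t
    from {p , _} pq∈flip with flip-𝓗⁻ pq∈flip
    ... | (i , refl) , flipped =
      u , v , ((i , refl) , FlippedOrder⇒< step-u step-v (𝓕-edge-≢ d≥2 pos u i) flipped) ,
      cong₂ _,_ (sym u⊕t≡p) (sym v⊕t≡p⊕eᵢ)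
      where
      -- The preimage is the given edge moved back by `t`.
      u = p ⊕ map ℤ.-_ t
      v = u ⊕ e i

      u⊕t≡p : u ⊕ t ≡ p
      u⊕t≡p = ⊕-neg-cancel p t

      v⊕t≡p⊕eᵢ : v ⊕ t ≡ p ⊕ e i
      v⊕t≡p⊕eᵢ = trans (⊕-swapʳ u (e i) t) (cong (_⊕ e i) u⊕t≡p)

      step-u : SucMod (sum a) (𝓕 u) (𝓕 p)
      step-u = subst (λ x → SucMod (sum a) (𝓕 u) (𝓕 x)) u⊕t≡p (step u)

      step-v : SucMod (sum a) (𝓕 v) (𝓕 (p ⊕ e i))
      step-v = subst (λ x → SucMod (sum a) (𝓕 v) (𝓕 x)) v⊕t≡p⊕eᵢ (step v)

proposition24 : (d : ℕ) (d≥2 : 2 ≤ d) (a : Vec ℕ d) (pos : Positive a) → RelativelyPrime a →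
    let open Christoffel a {{sum-nonZero d≥2 pos}} in
    (t : ℤ^ d) → 𝓕 t ≡ 1 → 𝓗 +ₜ t ≐ flip 𝓗
proposition24 d d≥2 a pos _ = 𝓗-translate a {{sum-nonZero d≥2 pos}} d≥2 pos
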